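{- Let $n, k$ be positive integers with $n \geq 3k-2 \geq 4$. Then $$g(n,k,2) \leq \binom{n+1}{k-1}+\binom{n}{k-2}.$$
   Context: Let $[n]=\{1,\dots,n\}$ and let $\binom{[n]}{k}$ be the family of all $k$-element subsets of $[n]$. For sets $A,B,C\subset[n]$ put $d(A,B,C)=|A\cap B|+|B\cap C|+|C\cap A|$. For a positive integer $\ell$, let $\mathbf{H}_\ell$ be the class of families $\mathcal{H}$ of subsets of $[n]$ such that $d(A,B,C)\ge \ell$ for all $A,B,C\in\mathcal{H}$ (no distinctness of $A,B,C$ is required in this definition). Define $g(n,k,\ell)=\max\{|\mathcal{F}| : \mathcal{F}\subset\binom{[n]}{k},\ \mathcal{F}\in\mathbf{H}_\ell\}$. -}

module Defs where

open import Data.Bool.Properties using () renaming (_≟_ to _≟ᵇ_)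
open import Data.Fin.Subset using (Subset; inside; outside; _∩_; ∣_∣)
open import Data.List using (List; []; _∷_; [_]; _++_; map; filter; length)
open import Data.List.Extrema.Nat using (max; argmax-sel; xs≤max)
open import Data.List.Membership.Propositional using (_∈_)
open import Data.List.Membership.Propositional.Properties using (∈-map⁺; ∈-map⁻; ∈-++⁺ˡ; ∈-++⁺ʳ; ∈-filter⁺; ∈-filter⁻; ∈-∃++; ∈-++⁻)
open import Data.List.Properties using (length-++)
open import Data.List.Relation.Unary.All as All using (All; []; _∷_; all?)
open import Data.List.Relation.Unary.AllPairs using ([]; _∷_)
open import Data.List.Relation.Unary.Any using (here; there)
open import Data.List.Relation.Unary.Unique.Propositional using (Unique)
import Data.List.Membership.DecPropositional as DecMembership
import Data.List.Relation.Unary.Unique.DecPropositional as DecUnique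
import Data.List.Relation.Unary.Unique.Propositional.Properties as Unique
open import Data.Nat using (ℕ; zero; suc; _+_; _≤_; z≤n; s≤s; _≤?_) renaming (_≟_ to _≟ⁿ_)
open import Data.Nat.Properties using (+-suc; ≤-trans; ≤-reflexive)
open import Data.Product using (Σ; _×_; _,_; proj₁; proj₂)
open import Data.Sum using (inj₁; inj₂)
open import Data.Vec using ([]; _∷_)
open import Data.Vec.Properties using (≡-dec; ∷-injectiveʳ)
open import Function using (id; _∘_)
open import Relation.Binary.Definitions using (DecidableEquality)
open import Relation.Binary.PropositionalEquality using (_≡_; refl; sym; trans; cong)
open import Relation.Nullary using (Dec; yes; no; ¬_; contradiction)
open import Relation.Nullary.Decidable using (map′; _×-dec_)

private
  variable
    n : ℕ

d : Subset n → Subset n → Subset n → ℕ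
d A B C = ∣ A ∩ B ∣ + ∣ B ∩ C ∣ + ∣ C ∩ A ∣

-- A family of subsets of [n] is a list without repetitions (the `Unique`
-- component of `Admissible`), so that `length` is its cardinality.

H : ℕ → List (Subset n) → Set
H ℓ 𝓗 = ∀ {A B C} → A ∈ 𝓗 → B ∈ 𝓗 → C ∈ 𝓗 → ℓ ≤ d A B C

Uniform : ℕ → List (Subset n) → Set
Uniform k 𝓕 = ∀ {A} → A ∈ 𝓕 → ∣ A ∣ ≡ k

Admissible : (n k ℓ : ℕ) → List (Subset n) → Set
Admissible n k ℓ 𝓕 = Unique 𝓕 × Uniform k 𝓕 × H ℓ 𝓕

_≟ˢ_ : DecidableEquality (Subset n)
_≟ˢ_ = ≡-dec _≟ᵇ_

H? : ∀ ℓ (𝓗 : List (Subset n)) → Dec (H ℓ 𝓗)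
H? ℓ 𝓗 = map′
  (λ p A∈ B∈ C∈ → All.lookup (All.lookup (All.lookup p A∈) B∈) C∈)
  (λ h → All.tabulate λ A∈ → All.tabulate λ B∈ → All.tabulate λ C∈ → h A∈ B∈ C∈)
  (all? (λ A → all? (λ B → all? (λ C → ℓ ≤? d A B C) 𝓗) 𝓗) 𝓗)

Uniform? : ∀ k (𝓕 : List (Subset n)) → Dec (Uniform k 𝓕)
Uniform? k 𝓕 = map′ (λ p → All.lookup p) (λ u → All.tabulate u) (all? (λ A → ∣ A ∣ ≟ⁿ k) 𝓕)

Admissible? : ∀ n k ℓ (𝓕 : List (Subset n)) → Dec (Admissible n k ℓ 𝓕)
Admissible? n k ℓ 𝓕 = DecUnique.unique? _≟ˢ_ 𝓕 ×-dec (Uniform? k 𝓕 ×-dec H? ℓ 𝓕)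

subsets : ∀ n → List (Subset n)
subsets zero    = [ [] ]
subsets (suc n) = map (outside ∷_) (subsets n) ++ map (inside ∷_) (subsets n)

sublists : {X : Set} → List X → List (List X)
sublists []       = [ [] ]
sublists (x ∷ xs) = sublists xs ++ map (x ∷_) (sublists xs)

-- The families of subsets of [n] are, up to reordering, the sublists of
-- `subsets n`. The base value 0 is the size of the empty family, which is
-- always admissible. That g is the maximum over all admissible families is
-- `g-attained` together with `g-upper`.

g : (n k ℓ : ℕ) → ℕ
g n k ℓ = max 0 (map length (filter (Admissible? n k ℓ) (sublists (subsets n))))

g-attained : ∀ n k ℓ → Σ (List (Subset n)) λ 𝓕 → Admissible n k ℓ 𝓕 × length 𝓕 ≡ g n k ℓ
g-attained n k ℓ with argmax-sel id 0 (map length (filter (Admissible? n k ℓ) (sublists (subsets n))))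
... | inj₁ eq = [] , ([] , (λ ()) , (λ ())) , sym eq
... | inj₂ g∈ with ∈-map⁻ length g∈
...   | 𝓕 , 𝓕∈ , eq = 𝓕 , proj₂ (∈-filter⁻ (Admissible? n k ℓ) {xs = sublists (subsets n)} 𝓕∈) , sym eq

private
  subsets-complete : (A : Subset n) → A ∈ subsets n
  subsets-complete []            = here refl
  subsets-complete (outside ∷ A) = ∈-++⁺ˡ (∈-map⁺ _ (subsets-complete A))
  subsets-complete (inside ∷ A)  = ∈-++⁺ʳ _ (∈-map⁺ _ (subsets-complete A))

  subsets-unique : ∀ n → Unique (subsets n)
  subsets-unique zero    = [] ∷ []
  subsets-unique (suc n) = Unique.++⁺
    (Unique.map⁺ ∷-injectiveʳ (subsets-unique n))
    (Unique.map⁺ ∷-injectiveʳ (subsets-unique n))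
    disjoint
    where
    disjoint : ∀ {A} → ¬ (A ∈ map (outside ∷_) (subsets n) × A ∈ map (inside ∷_) (subsets n))
    disjoint (p , q) with ∈-map⁻ _ p | ∈-map⁻ _ q
    ... | _ , _ , refl | _ , _ , ()

  filter∈sublists : {X : Set} {P : X → Set} (P? : ∀ x → Dec (P x)) (xs : List X) → filter P? xs ∈ sublists xs
  filter∈sublists P? []       = here refl
  filter∈sublists P? (x ∷ xs) with P? x
  ... | yes _ = ∈-++⁺ʳ (sublists xs) (∈-map⁺ (x ∷_) (filter∈sublists P? xs))
  ... | no  _ = ∈-++⁺ˡ (filter∈sublists P? xs)

  unique-length-≤ : {X : Set} {xs ys : List X} → Unique xs → (∀ {x} → x ∈ xs → x ∈ ys) → length xs ≤ length ys
  unique-length-≤ {xs = []}     []           _   = z≤n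
  unique-length-≤ {xs = x ∷ xs} (x∉ ∷ xs!) sub with ∈-∃++ (sub (here refl))
  ... | us , vs , refl = ≤-trans (s≤s (unique-length-≤ xs! sub′)) (≤-reflexive (sym length-eq))
    where
    length-eq : length (us ++ x ∷ vs) ≡ suc (length (us ++ vs))
    length-eq = trans (length-++ us) (trans (+-suc (length us) (length vs)) (cong suc (sym (length-++ us))))
    sub′ : ∀ {y} → y ∈ xs → y ∈ us ++ vs
    sub′ y∈ with ∈-++⁻ us (sub (there y∈))
    ... | inj₁ y∈us         = ∈-++⁺ˡ y∈us
    ... | inj₂ (here y≡x)   = contradiction (sym y≡x) (All.lookup x∉ y∈)
    ... | inj₂ (there y∈vs) = ∈-++⁺ʳ us y∈vs

g-upper : ∀ n k ℓ (𝓕 : List (Subset n)) → Admissible n k ℓ 𝓕 → length 𝓕 ≤ g n k ℓ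
g-upper n k ℓ 𝓕 (𝓕! , unif , h) = ≤-trans
  (unique-length-≤ 𝓕! (λ {A} A∈ → ∈-filter⁺ (_∈? 𝓕) (subsets-complete A) A∈))
  (All.lookup (xs≤max 0 _)
    (∈-map⁺ length (∈-filter⁺ (Admissible? n k ℓ) (filter∈sublists (_∈? 𝓕) (subsets n)) admissible)))
  where
  open DecMembership (_≟ˢ_ {n}) using (_∈?_)
  back : ∀ {A} → A ∈ filter (_∈? 𝓕) (subsets n) → A ∈ 𝓕
  back A∈ = proj₂ (∈-filter⁻ (_∈? 𝓕) {xs = subsets n} A∈)
  admissible : Admissible n k ℓ (filter (_∈? 𝓕) (subsets n))
  admissible = Unique.filter⁺ (_∈? 𝓕) (subsets-unique n)
             , unif ∘ back
             , λ A∈ B∈ C∈ → h (back A∈) (back B∈) (back C∈)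

{-# OPTIONS --safe #-}

-- Induction on n. When n = 3k - 2 the right-hand side is exactly C(n, k), so there is
-- nothing to prove. When n ≥ 3k - 1, shift a distinguished element e down to every other
-- element in turn; this preserves the size of the family and the condition d ≥ 2. The
-- members avoiding e form a k-uniform family on n - 1 points. The members containing e,
-- with e removed, form a (k-1)-uniform family on n - 1 points which again satisfies d ≥ 2:
-- if d(A, B, C) ≤ 1 there is enough room outside A ∪ B ∪ C to replace e by fresh elements
-- in one or two of the three sets, giving members of the shifted family with d ≤ 1.
-- The two bounds add up by Pascal's rule.

module Submission where

open import Defs
open import Data.Bool using (Bool; true; false; T; _∧_; _∨_; if_then_else_)
open import Data.Bool.Properties using (T-∧; T-∨; ∧-idem; ∨-idem; ∨-comm)
open import Data.Empty using (⊥; ⊥-elim)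
open import Data.Fin using (Fin; zero; suc)
open import Data.Fin.Subset using (Subset; ∣_∣; _∩_)
open import Data.Fin.Subset.Properties using (∩-idem)
open import Data.List using (List; []; _∷_; length; allFin)
open import Data.List.Membership.Propositional using (_∈_)
open import Data.List.Membership.Propositional.Properties using (∈-allFin)
open import Data.List.Relation.Unary.All as All using ()
open import Data.List.Relation.Unary.AllPairs using ([]; _∷_)
open import Data.List.Relation.Unary.Any using (here; there)
open import Data.List.Relation.Unary.Unique.Propositional using (Unique)
import Data.List.Membership.DecPropositional as DecMembership
open import Data.Nat using (ℕ; zero; suc; _+_; _*_; _∸_; _≤_; _<_; _≤ᵇ_; _≤?_; _≟_; z≤n; s≤s; s≤s⁻¹)
open import Data.Nat.Combinatorics using (_C_; nC1≡n; nCn≡1; nCk≡nC[n∸k]; k>n⇒nCk≡0; nCk+nC[k+1]≡[n+1]C[k+1])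
open import Data.Nat.Properties
open import Data.Nat.Tactic.RingSolver using (solve-∀)
open import Data.Product using (∃; _×_; _,_; proj₁; proj₂)
open import Data.Sum using (_⊎_; inj₁; inj₂)
open import Data.Vec using ([]; _∷_; lookup; _[_]≔_)
open import Data.Vec.Properties using ([]≔-lookup)
open import Function using (_∘_; Equivalence)
open import Relation.Binary.PropositionalEquality
open import Relation.Nullary using (¬_; yes; no; ⌊_⌋; contradiction)
open import Relation.Nullary.Decidable using (toWitness; fromWitness)

open Equivalence using (to; from)

private
  variable
    n k : ℕ

-- Families as Boolean predicates

Family : ℕ → Set
Family n = Subset n → Bool

-- The first element plays the role of e: `[ F ]₀` collects the members avoiding it, `[ F ]₁` is its
-- link.
[_]₀ [_]₁ : Family (suc n) → Family n
[ F ]₀ A = F (false ∷ A)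
[ F ]₁ A = F (true ∷ A)

bit : Bool → ℕ
bit b = if b then 1 else 0

size : Family n → ℕ
size {zero}  F = bit (F [])
size {suc n} F = size [ F ]₀ + size [ F ]₁

IsUniform : ℕ → Family n → Set
IsUniform k F = ∀ A → T (F A) → ∣ A ∣ ≡ k

D≥2 : Family n → Set
D≥2 F = ∀ A B D → T (F A) → T (F B) → T (F D) → 2 ≤ d A B D

+-interchange : ∀ a b c e → (a + b) + (c + e) ≡ (a + c) + (b + e)
+-interchange = solve-∀

+-interchange₃ : ∀ a b c e f h → (a + b) + (c + e) + (f + h) ≡ (a + c + f) + (b + e + h)
+-interchange₃ = solve-∀

-- Sizes of families

bit-mono : ∀ {a b} → (T a → T b) → bit a ≤ bit b
bit-mono {false}         _   = z≤n
bit-mono {true}  {true}  _   = ≤-refl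
bit-mono {true}  {false} a⇒b = ⊥-elim (a⇒b _)

size-mono : {F G : Family n} → (∀ A → T (F A) → T (G A)) → size F ≤ size G
size-mono {zero}  F⊆G = bit-mono (F⊆G [])
size-mono {suc n} F⊆G = +-mono-≤ (size-mono (F⊆G ∘ (false ∷_))) (size-mono (F⊆G ∘ (true ∷_)))

size-cong : {F G : Family n} → (∀ A → F A ≡ G A) → size F ≡ size G
size-cong F≗G = ≤-antisym (size-mono λ A → subst T (F≗G A)) (size-mono λ A → subst T (sym (F≗G A)))

size-empty : (F : Family n) → (∀ A → ¬ T (F A)) → size F ≡ 0
size-empty {zero} F ∅ with F [] in eq
... | false = refl
... | true  = ⊥-elim (∅ [] (subst T (sym eq) _))
size-empty {suc n} F ∅ = cong₂ _+_ (size-empty [ F ]₀ (∅ ∘ (false ∷_))) (size-empty [ F ]₁ (∅ ∘ (true ∷_)))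

size-strict-mono : {F G : Family n} (A : Subset n) → (∀ B → T (F B) → T (G B)) →
                   ¬ T (F A) → T (G A) → size F < size G
size-strict-mono {F = F} {G} [] F⊆G A∉F A∈G with F [] | G []
... | false | true  = ≤-refl
... | true  | _     = ⊥-elim (A∉F _)
size-strict-mono (false ∷ A) F⊆G A∉F A∈G =
  +-mono-<-≤ (size-strict-mono A (F⊆G ∘ (false ∷_)) A∉F A∈G) (size-mono (F⊆G ∘ (true ∷_)))
size-strict-mono (true ∷ A) F⊆G A∉F A∈G =
  +-mono-≤-< (size-mono (F⊆G ∘ (false ∷_))) (size-strict-mono A (F⊆G ∘ (true ∷_)) A∉F A∈G)

module _ {n : ℕ} where
  open DecMembership (_≟ˢ_ {n}) using (_∈?_)

  fromList : List (Subset n) → Family n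
  fromList 𝓕 A = ⌊ A ∈? 𝓕 ⌋

  ∈-fromList⁻ : ∀ {𝓕} A → T (fromList 𝓕 A) → A ∈ 𝓕
  ∈-fromList⁻ {𝓕} A = toWitness {a? = A ∈? 𝓕}

  -- A new head makes the predicate true at a set where it was false, so the size grows by at least
  -- one with each entry.
  length≤size : ∀ {𝓕} → Unique 𝓕 → length 𝓕 ≤ size (fromList 𝓕)
  length≤size []                    = z≤n
  length≤size {A ∷ 𝓕} (A∉𝓕 ∷ 𝓕!) = ≤-trans (s≤s (length≤size 𝓕!))
    (size-strict-mono A
      (λ B B∈ → fromWitness {a? = B ∈? (A ∷ 𝓕)} (there (∈-fromList⁻ B B∈)))
      (λ A∈ → All.lookup A∉𝓕 (∈-fromList⁻ A A∈) refl)
      (fromWitness {a? = A ∈? (A ∷ 𝓕)} (here refl)))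

-- Inclusion-exclusion. It keeps the size fixed under shifting, which replaces two slices by their
-- intersection and their union.
size-∧-∨ : (F G : Family n) → size (λ A → F A ∧ G A) + size (λ A → F A ∨ G A) ≡ size F + size G
size-∧-∨ {zero} F G with F [] | G []
... | false | _     = refl
... | true  | false = refl
... | true  | true  = refl
size-∧-∨ {suc n} F G = begin
  (size (λ A → F (false ∷ A) ∧ G (false ∷ A)) + size (λ A → F (true ∷ A) ∧ G (true ∷ A))) +
  (size (λ A → F (false ∷ A) ∨ G (false ∷ A)) + size (λ A → F (true ∷ A) ∨ G (true ∷ A)))
    ≡⟨ +-interchange (size (λ A → F (false ∷ A) ∧ G (false ∷ A))) _ _ _ ⟩
  (size (λ A → F (false ∷ A) ∧ G (false ∷ A)) + size (λ A → F (false ∷ A) ∨ G (false ∷ A))) +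
  (size (λ A → F (true ∷ A) ∧ G (true ∷ A)) + size (λ A → F (true ∷ A) ∨ G (true ∷ A)))
    ≡⟨ cong₂ _+_ (size-∧-∨ [ F ]₀ [ G ]₀) (size-∧-∨ [ F ]₁ [ G ]₁) ⟩
  (size [ F ]₀ + size [ G ]₀) + (size [ F ]₁ + size [ G ]₁)
    ≡⟨ +-interchange (size [ F ]₀) _ _ _ ⟩
  (size [ F ]₀ + size [ F ]₁) + (size [ G ]₀ + size [ G ]₁) ∎
  where
  open ≡-Reasoning

-- The function d

-- The contribution to `d` of one element whose memberships in the three sets are `a`, `b`, `c`.
δ : Bool → Bool → Bool → ℕ
δ a b c = bit (a ∧ b) + bit (b ∧ c) + bit (c ∧ a)

∣∷∣ : ∀ b (A : Subset n) → ∣ b ∷ A ∣ ≡ bit b + ∣ A ∣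
∣∷∣ false A = refl
∣∷∣ true  A = refl

d-∷ : ∀ a b c (A B D : Subset n) → d (a ∷ A) (b ∷ B) (c ∷ D) ≡ δ a b c + d A B D
d-∷ a b c A B D = trans
  (cong₂ _+_ (cong₂ _+_ (∣∷∣ (a ∧ b) (A ∩ B)) (∣∷∣ (b ∧ c) (B ∩ D))) (∣∷∣ (c ∧ a) (D ∩ A)))
  (+-interchange₃ (bit (a ∧ b)) _ (bit (b ∧ c)) _ (bit (c ∧ a)) _)

d-outside : Fin n → (A B D : Subset n) → ℕ
d-outside x A B D = d (A [ x ]≔ false) (B [ x ]≔ false) (D [ x ]≔ false)

d-[]≔ : ∀ (x : Fin n) a b c A B D →
        d (A [ x ]≔ a) (B [ x ]≔ b) (D [ x ]≔ c) ≡ δ a b c + d-outside x A B D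
d-[]≔ zero    a b c (_ ∷ A) (_ ∷ B) (_ ∷ D) = d-∷ a b c A B D
d-[]≔ (suc x) a b c (p ∷ A) (q ∷ B) (r ∷ D) = begin
  d (p ∷ A [ x ]≔ a) (q ∷ B [ x ]≔ b) (r ∷ D [ x ]≔ c)   ≡⟨ d-∷ p q r (A [ x ]≔ a) (B [ x ]≔ b) (D [ x ]≔ c) ⟩
  δ p q r + d (A [ x ]≔ a) (B [ x ]≔ b) (D [ x ]≔ c)     ≡⟨ cong (δ p q r +_) (d-[]≔ x a b c A B D) ⟩
  δ p q r + (δ a b c + d-outside x A B D)                    ≡⟨ swap (δ p q r) (δ a b c) _ ⟩
  δ a b c + (δ p q r + d-outside x A B D)                    ≡⟨ cong (δ a b c +_) (d-∷ p q r (A [ x ]≔ false) (B [ x ]≔ false) (D [ x ]≔ false)) ⟨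
  δ a b c + d-outside (suc x) (p ∷ A) (q ∷ B) (r ∷ D)        ∎
  where
  open ≡-Reasoning
  swap : ∀ u v w → u + (v + w) ≡ v + (u + w)
  swap = solve-∀

-- An element outside `B` and `D` lies in none of the three intersections, whether or not it is in
-- `A`.
d-fresh₁ : ∀ (x : Fin n) a A B D → lookup B x ≡ false → lookup D x ≡ false →
           d (A [ x ]≔ a) B D ≡ d A B D
d-fresh₁ zero a (p ∷ A) (false ∷ B) (false ∷ D) refl refl = begin
  d (a ∷ A) (false ∷ B) (false ∷ D) ≡⟨ d-∷ a false false A B D ⟩
  δ a false false + d A B D         ≡⟨ cong (_+ d A B D) (δ-false a) ⟩
  d A B D                           ≡⟨ cong (_+ d A B D) (δ-false p) ⟨
  δ p false false + d A B D         ≡⟨ d-∷ p false false A B D ⟨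
  d (p ∷ A) (false ∷ B) (false ∷ D) ∎
  where
  open ≡-Reasoning
  δ-false : ∀ b → δ b false false ≡ 0
  δ-false false = refl
  δ-false true  = refl
d-fresh₁ (suc x) a (p ∷ A) (q ∷ B) (r ∷ D) x∉B x∉D = trans (d-∷ p q r _ B D)
  (trans (cong (δ p q r +_) (d-fresh₁ x a A B D x∉B x∉D)) (sym (d-∷ p q r A B D)))

d-rotate : (A B D : Subset n) → d A B D ≡ d B D A
d-rotate []      []      []      = refl
d-rotate (a ∷ A) (b ∷ B) (c ∷ D) = begin
  d (a ∷ A) (b ∷ B) (c ∷ D) ≡⟨ d-∷ a b c A B D ⟩
  δ a b c + d A B D         ≡⟨ cong₂ _+_ (rotate (bit (a ∧ b)) _ _) (d-rotate A B D) ⟩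
  δ b c a + d B D A         ≡⟨ d-∷ b c a B D A ⟨
  d (b ∷ B) (c ∷ D) (a ∷ A) ∎
  where
  open ≡-Reasoning
  rotate : ∀ u v w → u + v + w ≡ v + w + u
  rotate = solve-∀

d-fresh₂ : ∀ (x : Fin n) b A B D → lookup D x ≡ false → lookup A x ≡ false →
           d A (B [ x ]≔ b) D ≡ d A B D
d-fresh₂ x b A B D x∉D x∉A = trans (d-rotate A (B [ x ]≔ b) D)
  (trans (d-fresh₁ x b B D A x∉D x∉A) (sym (d-rotate A B D)))

-- If d ≤ 1 then no element lies in all three sets, so ∣A∣ + ∣B∣ + ∣D∣ = ∣A ∪ B ∪ D∣ + d.
common-fresh : (A B D : Subset n) → d A B D ≤ 1 → ∣ A ∣ + ∣ B ∣ + ∣ D ∣ < n + d A B D →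
               ∃ λ x → lookup A x ≡ false × lookup B x ≡ false × lookup D x ≡ false
common-fresh [] [] [] _ ()
common-fresh {suc n} (a ∷ A) (b ∷ B) (c ∷ D) d≤1 room = step a b c
  (≤-trans (≤-reflexive (sym (d-∷ a b c A B D))) d≤1)
  (subst₂ _<_ lhs≡ (cong (suc n +_) (d-∷ a b c A B D)) room)
  where
  lhs≡ : ∣ a ∷ A ∣ + ∣ b ∷ B ∣ + ∣ c ∷ D ∣ ≡ (bit a + bit b + bit c) + (∣ A ∣ + ∣ B ∣ + ∣ D ∣)
  lhs≡ = trans (cong₂ _+_ (cong₂ _+_ (∣∷∣ a A) (∣∷∣ b B)) (∣∷∣ c D)) (+-interchange₃ (bit a) _ (bit b) _ (bit c) _)
  Fresh : ∀ {m} → Subset m → Subset m → Subset m → Set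
  Fresh A B D = ∃ λ x → lookup A x ≡ false × lookup B x ≡ false × lookup D x ≡ false
  later : ∀ {a b c} → Fresh A B D → Fresh (a ∷ A) (b ∷ B) (c ∷ D)
  later (x , p) = suc x , p
  -- An element in exactly one set adds 1 to the sizes and 0 to `d`; one in exactly two sets adds 2
  -- and 1. As n also grows by 1, the spare room is the same either way.
  one : d A B D ≤ 1 → suc (∣ A ∣ + ∣ B ∣ + ∣ D ∣) < suc n + d A B D → Fresh A B D
  one d≤1 room = common-fresh A B D d≤1 (s≤s⁻¹ room)
  two : suc (d A B D) ≤ 1 → 2 + (∣ A ∣ + ∣ B ∣ + ∣ D ∣) < suc n + suc (d A B D) → Fresh A B D
  two d≤0 room = common-fresh A B D (≤-trans (n≤1+n _) d≤0)
    (s≤s⁻¹ (subst (suc (∣ A ∣ + ∣ B ∣ + ∣ D ∣) <_) (+-suc n (d A B D)) (s≤s⁻¹ room)))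
  step : ∀ a b c → δ a b c + d A B D ≤ 1 →
         (bit a + bit b + bit c) + (∣ A ∣ + ∣ B ∣ + ∣ D ∣) < suc n + (δ a b c + d A B D) →
         Fresh (a ∷ A) (b ∷ B) (c ∷ D)
  step false false false _        _    = zero , refl , refl , refl
  step false false true  d≤1      room = later (one d≤1 room)
  step false true  false d≤1      room = later (one d≤1 room)
  step true  false false d≤1      room = later (one d≤1 room)
  step false true  true  d≤1      room = later (two d≤1 room)
  step true  false true  d≤1      room = later (two d≤1 room)
  step true  true  false d≤1      room = later (two d≤1 room)
  step true  true  true  (s≤s ()) _

-- Shifting

swap : Fin n → Subset (suc n) → Subset (suc n)
swap x (h ∷ A) = lookup A x ∷ A [ x ]≔ h

-- On sets that contain both or neither of the first element and x, `swap x` is the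
-- identity, so that only the two remaining kinds of sets are affected.
shift : Fin n → Family (suc n) → Family (suc n)
shift x F (true  ∷ A) = F (true ∷ A)  ∧ F (swap x (true ∷ A))
shift x F (false ∷ A) = F (false ∷ A) ∨ F (swap x (false ∷ A))

-- If x is the second element, the slices with equal first two bits are unchanged and the two mixed
-- ones become their intersection and union. Otherwise the shift leaves the second bit alone and
-- acts separately on the two slices that fix it.
size-shift : (x : Fin n) (F : Family (suc n)) → size (shift x F) ≡ size F
size-shift {suc n} zero F = begin
  (size (λ A → F₀₀ A ∨ F₀₀ A) + size (λ A → F₀₁ A ∨ F₁₀ A)) +
  (size (λ A → F₁₀ A ∧ F₀₁ A) + size (λ A → F₁₁ A ∧ F₁₁ A))
    ≡⟨ regroup (size (λ A → F₀₀ A ∨ F₀₀ A)) _ _ _ ⟩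
  size (λ A → F₀₀ A ∨ F₀₀ A) + (size (λ A → F₁₀ A ∧ F₀₁ A) + size (λ A → F₀₁ A ∨ F₁₀ A)) +
  size (λ A → F₁₁ A ∧ F₁₁ A)
    ≡⟨ cong₂ _+_ (cong₂ _+_ (size-cong λ A → ∨-idem (F₀₀ A)) middle) (size-cong λ A → ∧-idem (F₁₁ A)) ⟩
  size F₀₀ + (size F₁₀ + size F₀₁) + size F₁₁
    ≡⟨ regroup (size F₀₀) _ _ _ ⟨
  (size F₀₀ + size F₀₁) + (size F₁₀ + size F₁₁) ∎
  where
  open ≡-Reasoning
  F₀₀ F₀₁ F₁₀ F₁₁ : Family n
  F₀₀ = [ [ F ]₀ ]₀
  F₀₁ = [ [ F ]₀ ]₁
  F₁₀ = [ [ F ]₁ ]₀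
  F₁₁ = [ [ F ]₁ ]₁
  middle : size (λ A → F₁₀ A ∧ F₀₁ A) + size (λ A → F₀₁ A ∨ F₁₀ A) ≡ size F₁₀ + size F₀₁
  middle = trans (cong (size (λ A → F₁₀ A ∧ F₀₁ A) +_) (size-cong λ A → ∨-comm (F₀₁ A) (F₁₀ A)))
                 (size-∧-∨ F₁₀ F₀₁)
  regroup : ∀ a b c e → (a + b) + (c + e) ≡ a + (c + b) + e
  regroup = solve-∀
size-shift {suc n} (suc x) F = begin
  (size [ [ F′ ]₀ ]₀ + size [ [ F′ ]₀ ]₁) + (size [ [ F′ ]₁ ]₀ + size [ [ F′ ]₁ ]₁)
    ≡⟨ +-interchange (size [ [ F′ ]₀ ]₀) _ _ _ ⟩
  size (shift x (slice false)) + size (shift x (slice true))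
    ≡⟨ cong₂ _+_ (size-shift x (slice false)) (size-shift x (slice true)) ⟩
  size (slice false) + size (slice true)
    ≡⟨ +-interchange (size [ [ F ]₀ ]₀) _ _ _ ⟩
  (size [ [ F ]₀ ]₀ + size [ [ F ]₀ ]₁) + (size [ [ F ]₁ ]₀ + size [ [ F ]₁ ]₁) ∎
  where
  open ≡-Reasoning
  F′ = shift (suc x) F
  slice : Bool → Family (suc n)
  slice b (h ∷ A) = F (h ∷ b ∷ A)

∣swap∣ : (x : Fin n) (A : Subset (suc n)) → ∣ swap x A ∣ ≡ ∣ A ∣
∣swap∣ zero    (false ∷ false ∷ A) = refl
∣swap∣ zero    (false ∷ true  ∷ A) = refl
∣swap∣ zero    (true  ∷ false ∷ A) = refl
∣swap∣ zero    (true  ∷ true  ∷ A) = refl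
∣swap∣ (suc x) (h ∷ b ∷ A) = begin
  ∣ lookup A x ∷ b ∷ A [ x ]≔ h ∣            ≡⟨ expand (lookup A x) b (A [ x ]≔ h) ⟩
  bit b + ∣ lookup A x ∷ A [ x ]≔ h ∣        ≡⟨ cong (bit b +_) (∣swap∣ x (h ∷ A)) ⟩
  bit b + ∣ h ∷ A ∣                          ≡⟨ expand h b A ⟨
  ∣ h ∷ b ∷ A ∣                              ∎
  where
  open ≡-Reasoning
  expand : ∀ {n} a b (A : Subset n) → ∣ a ∷ b ∷ A ∣ ≡ bit b + ∣ a ∷ A ∣
  expand false b     A = ∣∷∣ b A
  expand true  false A = refl
  expand true  true  A = refl

shift-uniform : ∀ (x : Fin n) {F} → IsUniform k F → IsUniform k (shift x F)
shift-uniform x unif (true  ∷ A) A∈ = unif _ (proj₁ (to T-∧ A∈))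
shift-uniform x unif (false ∷ A) A∈ with to T-∨ A∈
... | inj₁ old = unif _ old
... | inj₂ new = trans (sym (∣swap∣ x (false ∷ A))) (unif _ new)

-- P p a says that the set whose bits at the first element and at x are p and a, and
-- which is otherwise fixed, belongs to the original family.
data Origin (P : Bool → Bool → Set) : Bool → Bool → Set where
  both : ∀ {p a} → P p a → P a p → Origin P p a
  old  : P false true → Origin P false true
  new  : P true false → Origin P false true

-- A member containing the first element has its swap in `F` too, and a set with neither element is
-- its own swap. Hence `old` and `new` arise only for sets containing x but not the first element.
shift-origin : ∀ (x : Fin n) F h A → T (shift x F (h ∷ A)) →
               Origin (λ p a → T (F (p ∷ A [ x ]≔ a))) h (lookup A x)
shift-origin x F true A A∈ = both
  (subst (λ B → T (F (true ∷ B))) (sym ([]≔-lookup A x)) (proj₁ (to T-∧ A∈)))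
  (proj₂ (to T-∧ A∈))
shift-origin {n} x F false A A∈ = origin (lookup A x) refl (to T-∨ A∈)
  where
  P : Bool → Bool → Set
  P p a = T (F (p ∷ A [ x ]≔ a))
  restore : ∀ {a} → lookup A x ≡ a → A ≡ A [ x ]≔ a
  restore refl = sym ([]≔-lookup A x)
  origin : ∀ a → lookup A x ≡ a → T (F (false ∷ A)) ⊎ P a false → Origin P false a
  origin false eq (inj₁ A∈F) = let A∈F′ = subst (T ∘ F ∘ (false ∷_)) (restore eq) A∈F in both A∈F′ A∈F′
  origin true  eq (inj₁ A∈F) = old (subst (T ∘ F ∘ (false ∷_)) (restore eq) A∈F)
  origin false _  (inj₂ A∈F) = both A∈F A∈F
  origin true  _  (inj₂ A∈F) = new A∈F

-- Three members of the original family that differ from the shifted ones at most in the first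
-- element and x, and whose contribution to `d` from these two elements is no larger.
data Improvement (P Q R : Bool → Bool → Set) (p a q b r c : Bool) : Set where
  improvement : ∀ {p′ a′ q′ b′ r′ c′} → P p′ a′ → Q q′ b′ → R r′ c′ →
                δ p′ q′ r′ + δ a′ b′ c′ ≤ δ p q r + δ a b c → Improvement P Q R p a q b r c

-- Proof by evaluation: for concrete `f` and `g` the four tests reduce to the unit type, so the
-- implicit arguments are filled in automatically.
≤-byBits : (f g : Bool → Bool → ℕ)
           {_ : T (f false false ≤ᵇ g false false)} {_ : T (f false true ≤ᵇ g false true)}
           {_ : T (f true false ≤ᵇ g true false)} {_ : T (f true true ≤ᵇ g true true)} →
           ∀ p a → f p a ≤ g p a
≤-byBits f g {t} false false         = ≤ᵇ⇒≤ _ _ t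
≤-byBits f g {_} {t} false true      = ≤ᵇ⇒≤ _ _ t
≤-byBits f g {_} {_} {t} true false  = ≤ᵇ⇒≤ _ _ t
≤-byBits f g {_} {_} {_} {t} true true = ≤ᵇ⇒≤ _ _ t

-- If none of the three is `old`, swapping all of them leaves the total unchanged; if
-- some is, it suffices to undo the swap of those that are `new`.
improve : ∀ {P Q R p a q b r c} → Origin P p a → Origin Q q b → Origin R r c →
          Improvement P Q R p a q b r c
improve (both {p} {a} _ u) (both {q} {b} _ v) (both {r} {c} _ w) = improvement u v w
  (≤-reflexive (+-comm (δ a b c) (δ p q r)))
improve (both u _) (both v _) (old w) = improvement u v w ≤-refl
improve (both {p} {a} _ u) (both {q} {b} _ v) (new w) = improvement u v w
  (≤-reflexive (+-comm (δ a b true) (δ p q false)))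
improve (both u _) (old v) (both w _) = improvement u v w ≤-refl
improve (both u _) (old v) (old w) = improvement u v w ≤-refl
improve (both {p} {a} u _) (old v) (new w) = improvement u v w
  (≤-byBits (λ p a → δ p false true + δ a true false) (λ p a → δ p false false + δ a true true) p a)
improve (both {p} {a} _ u) (new v) (both {r} {c} _ w) = improvement u v w
  (≤-reflexive (+-comm (δ a true c) (δ p false r)))
improve (both {p} {a} u _) (new v) (old w) = improvement u v w
  (≤-byBits (λ p a → δ p true false + δ a false true) (λ p a → δ p false false + δ a true true) p a)
improve (both {p} {a} _ u) (new v) (new w) = improvement u v w
  (≤-reflexive (+-comm (δ a true true) (δ p false false)))
improve (old u) (both v _) (both w _) = improvement u v w ≤-refl
improve (old u) (both v _) (old w) = improvement u v w ≤-refl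
improve (old u) (both {q} {b} v _) (new w) = improvement u v w
  (≤-byBits (λ q b → δ false q true + δ true b false) (λ q b → δ false q false + δ true b true) q b)
improve (old u) (old v) (both w _) = improvement u v w ≤-refl
improve (old u) (old v) (old w) = improvement u v w ≤-refl
improve (old u) (old v) (new w) = improvement u v w (≤ᵇ⇒≤ _ _ _)
improve (old u) (new v) (both {r} {c} w _) = improvement u v w
  (≤-byBits (λ r c → δ false true r + δ true false c) (λ r c → δ false false r + δ true true c) r c)
improve (old u) (new v) (old w) = improvement u v w (≤ᵇ⇒≤ _ _ _)
improve (old u) (new v) (new w) = improvement u v w (≤ᵇ⇒≤ _ _ _)
improve (new u) (both {q} {b} _ v) (both {r} {c} _ w) = improvement u v w
  (≤-reflexive (+-comm (δ true b c) (δ false q r)))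
improve (new u) (both {q} {b} v _) (old w) = improvement u v w
  (≤-byBits (λ q b → δ true q false + δ false b true) (λ q b → δ false q false + δ true b true) q b)
improve (new u) (both {q} {b} _ v) (new w) = improvement u v w
  (≤-reflexive (+-comm (δ true b true) (δ false q false)))
improve (new u) (old v) (both {r} {c} w _) = improvement u v w
  (≤-byBits (λ r c → δ true false r + δ false true c) (λ r c → δ false false r + δ true true c) r c)
improve (new u) (old v) (old w) = improvement u v w (≤ᵇ⇒≤ _ _ _)
improve (new u) (old v) (new w) = improvement u v w (≤ᵇ⇒≤ _ _ _)
improve (new u) (new v) (both {r} {c} _ w) = improvement u v w
  (≤-reflexive (+-comm (δ true true c) (δ false false r)))
improve (new u) (new v) (old w) = improvement u v w (≤ᵇ⇒≤ _ _ _)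
improve (new u) (new v) (new w) = improvement u v w
  (≤-reflexive (+-comm (δ true true true) (δ false false false)))

-- All elements other than the first and x contribute `d-outside` before and after, so an
-- `Improvement` yields members of `F` whose `d` is a lower bound for the given one.
shift-D≥2 : ∀ (x : Fin n) {F} → D≥2 F → D≥2 (shift x F)
shift-D≥2 x {F} F≥2 (p ∷ A) (q ∷ B) (r ∷ D) A∈ B∈ D∈
  with improve (shift-origin x F p A A∈) (shift-origin x F q B B∈) (shift-origin x F r D D∈)
... | improvement {p′} {a′} {q′} {b′} {r′} {c′} A∈F B∈F D∈F δ≤ = begin
  2                                                          ≤⟨ F≥2 _ _ _ A∈F B∈F D∈F ⟩
  d (p′ ∷ A [ x ]≔ a′) (q′ ∷ B [ x ]≔ b′) (r′ ∷ D [ x ]≔ c′) ≡⟨ split p′ a′ q′ b′ r′ c′ ⟩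
  (δ p′ q′ r′ + δ a′ b′ c′) + d-outside x A B D                ≤⟨ +-monoˡ-≤ _ δ≤ ⟩
  (δ p q r + δ a b c) + d-outside x A B D                      ≡⟨ split p a q b r c ⟨
  d (p ∷ A [ x ]≔ a) (q ∷ B [ x ]≔ b) (r ∷ D [ x ]≔ c)       ≡⟨ restore ⟩
  d (p ∷ A) (q ∷ B) (r ∷ D)                                  ∎
  where
  open ≤-Reasoning
  a = lookup A x
  b = lookup B x
  c = lookup D x
  split : ∀ p a q b r c → d (p ∷ A [ x ]≔ a) (q ∷ B [ x ]≔ b) (r ∷ D [ x ]≔ c) ≡
                          (δ p q r + δ a b c) + d-outside x A B D
  split p a q b r c = trans (d-∷ p q r (A [ x ]≔ a) (B [ x ]≔ b) (D [ x ]≔ c))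
    (trans (cong (δ p q r +_) (d-[]≔ x a b c A B D)) (sym (+-assoc (δ p q r) _ _)))
  restore : d (p ∷ A [ x ]≔ a) (q ∷ B [ x ]≔ b) (r ∷ D [ x ]≔ c) ≡ d (p ∷ A) (q ∷ B) (r ∷ D)
  restore rewrite []≔-lookup A x | []≔-lookup B x | []≔-lookup D x = refl

-- Stability: families fixed by shifts

Stable : Fin n → Family (suc n) → Set
Stable x F = ∀ A → T ([ F ]₁ A) → lookup A x ≡ false → T ([ F ]₀ (A [ x ]≔ true))

-- Shifts enlarge [ F ]₀ and diminish [ F ]₁.
_⊑_ : Family (suc n) → Family (suc n) → Set
F ⊑ G = (∀ A → T ([ F ]₀ A) → T ([ G ]₀ A)) × (∀ A → T ([ G ]₁ A) → T ([ F ]₁ A))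

⊑-shift : ∀ (x : Fin n) F → F ⊑ shift x F
⊑-shift x F = (λ A → from T-∨ ∘ inj₁) , (λ A → proj₁ ∘ to T-∧)

shift-stable : ∀ (x : Fin n) F → Stable x (shift x F)
shift-stable x F A A∈ x∉A = from T-∨ (inj₁
  (subst (λ b → T (F (b ∷ A [ x ]≔ true))) x∉A (proj₂ (to (T-∧ {F (true ∷ A)}) A∈))))

-- Stability has `[ F ]₁` in its hypothesis and `[ F ]₀` in its conclusion, so shrinking the former
-- and enlarging the latter preserves it. Later shifts therefore do not undo earlier ones.
Stable-⊑ : ∀ (x : Fin n) F G → F ⊑ G → Stable x F → Stable x G
Stable-⊑ x F G (F₀⊆G₀ , G₁⊆F₁) stable A A∈ x∉A = F₀⊆G₀ _ (stable A (G₁⊆F₁ A A∈) x∉A)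

-- The result of shifting to every element of `xs` in one pass. The field `F⊑` transports the
-- stability gained at the head through the remaining shifts.
record Compression (k : ℕ) (xs : List (Fin n)) (F : Family (suc n)) : Set where
  field
    family  : Family (suc n)
    size≡   : size family ≡ size F
    uniform : IsUniform k family
    d≥2     : D≥2 family
    stable  : ∀ {x} → x ∈ xs → Stable x family
    F⊑      : F ⊑ family

compress : ∀ xs (F : Family (suc n)) → IsUniform k F → D≥2 F → Compression k xs F
compress []       F unif F≥2 = record
  { family = F ; size≡ = refl ; uniform = unif ; d≥2 = F≥2 ; stable = λ () ; F⊑ = (λ _ A∈ → A∈) , (λ _ A∈ → A∈) }
compress (x ∷ xs) F unif F≥2 = record
  { family  = family
  ; size≡   = trans size≡ (size-shift x F)
  ; uniform = uniform
  ; d≥2     = d≥2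
  ; stable  = λ { (here refl) → Stable-⊑ x (shift x F) family F⊑ (shift-stable x F) ; (there y∈) → stable y∈ }
  ; F⊑      = (λ A → proj₁ F⊑ A ∘ proj₁ (⊑-shift x F) A) , (λ A → proj₂ (⊑-shift x F) A ∘ proj₂ F⊑ A)
  }
  where open Compression (compress xs (shift x F) (shift-uniform x {F} unif) (shift-D≥2 x {F} F≥2))

-- The link of the distinguished element

-- The numerical hypothesis says 3k < n, so three link members with `d` at most 1 leave a common
-- fresh element. Stability then lets fresh elements replace e in one or two of the sets.
link-D≥2 : ∀ (F : Family (suc n)) → IsUniform (suc k) F → D≥2 F → (∀ x → Stable x F) →
           3 * suc k ≤ n + 2 → D≥2 [ F ]₁
link-D≥2 {n} {k} F unif F≥2 stable 3k≤ A B D A∈ B∈ D∈ with 2 ≤? d A B D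
... | yes 2≤d = 2≤d
... | no  2≰d = ⊥-elim (absurd (d A B D) refl d≤1)
  where
  open ≤-Reasoning
  d≤1 : d A B D ≤ 1
  d≤1 = s≤s⁻¹ (≰⇒> 2≰d)
  ∣_∈₁∣ : ∀ {A} → T ([ F ]₁ A) → ∣ A ∣ ≡ k
  ∣ A∈ ∈₁∣ = suc-injective (unif _ A∈)
  k+k+k<n : k + k + k < n
  k+k+k<n = +-cancelʳ-≤ 2 _ _ (subst (_≤ n + 2) (arith k) 3k≤)
    where
    arith : ∀ k → 3 * suc k ≡ suc (k + k + k) + 2
    arith = solve-∀
  room : ∣ A ∣ + ∣ B ∣ + ∣ D ∣ < n + d A B D
  room = begin-strict
    ∣ A ∣ + ∣ B ∣ + ∣ D ∣ ≡⟨ cong₂ _+_ (cong₂ _+_ ∣ A∈ ∈₁∣ ∣ B∈ ∈₁∣) ∣ D∈ ∈₁∣ ⟩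
    k + k + k             <⟨ k+k+k<n ⟩
    n                     ≤⟨ m≤m+n n _ ⟩
    n + d A B D           ∎
  fresh = common-fresh A B D d≤1 room
  x = proj₁ fresh
  A′ = A [ x ]≔ true
  A′∈ : T ([ F ]₀ A′)
  A′∈ = stable x A A∈ (proj₁ (proj₂ fresh))
  dA′≡ : d A′ B D ≡ d A B D
  dA′≡ = d-fresh₁ x true A B D (proj₁ (proj₂ (proj₂ fresh))) (proj₂ (proj₂ (proj₂ fresh)))
  absurd : ∀ m → d A B D ≡ m → m ≤ 1 → ⊥
  -- Only `A` gives up e. Then e lies in the other two sets and contributes 1, the fresh x
  -- contributes nothing, and the total is 1.
  absurd zero d≡0 _ = contradiction (F≥2 _ _ _ A′∈ B∈ D∈) (<⇒≱ (begin-strict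
    d (false ∷ A′) (true ∷ B) (true ∷ D) ≡⟨ d-∷ false true true A′ B D ⟩
    1 + d A′ B D                         ≡⟨ cong suc (trans dA′≡ d≡0) ⟩
    1                                    <⟨ ≤-refl ⟩
    2                                    ∎))
  -- Both `A` and `B` give up e, which then lies in one set only and contributes nothing; the total
  -- stays 1. The second fresh element y avoids `A′`, hence differs from x.
  absurd (suc zero) d≡1 _ = contradiction (F≥2 _ _ _ A′∈ B′∈ D∈) (<⇒≱ (begin-strict
    d (false ∷ A′) (false ∷ B′) (true ∷ D) ≡⟨ d-∷ false false true A′ B′ D ⟩
    d A′ B′ D                              ≡⟨ d-fresh₂ y true A′ B D (proj₂ (proj₂ (proj₂ fresh′))) (proj₁ (proj₂ fresh′)) ⟩
    d A′ B D                               ≡⟨ trans dA′≡ d≡1 ⟩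
    1                                      <⟨ ≤-refl ⟩
    2                                      ∎))
    where
    -- The element x added to `A` costs one unit of room, which `d` = 1 supplies.
    room′ : ∣ A′ ∣ + ∣ B ∣ + ∣ D ∣ < n + d A′ B D
    room′ = begin-strict
      ∣ A′ ∣ + ∣ B ∣ + ∣ D ∣ ≡⟨ cong₂ _+_ (cong₂ _+_ (unif _ A′∈) ∣ B∈ ∈₁∣) ∣ D∈ ∈₁∣ ⟩
      suc (k + k + k)        <⟨ s≤s k+k+k<n ⟩
      suc n                  ≡⟨ +-comm 1 n ⟩
      n + 1                  ≡⟨ cong (n +_) (trans dA′≡ d≡1) ⟨
      n + d A′ B D           ∎
    fresh′ = common-fresh A′ B D (≤-trans (≤-reflexive dA′≡) d≤1) room′
    y = proj₁ fresh′
    B′ = B [ y ]≔ true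
    B′∈ : T ([ F ]₀ B′)
    B′∈ = stable y B B∈ (proj₁ (proj₂ (proj₂ fresh′)))
  absurd (suc (suc _)) _ (s≤s ())

-- Binomial coefficients

nC0≡1 : ∀ n → n C 0 ≡ 1
nC0≡1 n = trans (nCk≡nC[n∸k] {0} {n} z≤n) (nCn≡1 n)

-- (k + 1) C(n, k + 1) = (n - k) C(n, k), without subtraction.
nCk-absorb : ∀ n k → suc k * (n C suc k) + k * (n C k) ≡ n * (n C k)
nCk-absorb zero    zero    = refl
nCk-absorb zero    (suc k) = cong₂ _+_
  (trans (cong (suc (suc k) *_) (k>n⇒nCk≡0 {0} {suc (suc k)} (s≤s z≤n))) (*-zeroʳ (suc (suc k))))
  (trans (cong (suc k *_) (k>n⇒nCk≡0 {0} {suc k} (s≤s z≤n))) (*-zeroʳ (suc k)))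
nCk-absorb (suc n) zero    = begin
  1 * (suc n C 1) + 0     ≡⟨ cong (λ c → 1 * c + 0) (nC1≡n (suc n)) ⟩
  1 * suc n + 0           ≡⟨ arith n ⟩
  suc n * 1               ≡⟨ cong (suc n *_) (nC0≡1 (suc n)) ⟨
  suc n * (suc n C 0)     ∎
  where
  open ≡-Reasoning
  arith : ∀ n → 1 * suc n + 0 ≡ suc n * 1
  arith = solve-∀
nCk-absorb (suc n) (suc k) = begin
  suc (suc k) * (suc n C suc (suc k)) + suc k * (suc n C suc k)
    ≡⟨ cong₂ (λ u v → suc (suc k) * u + suc k * v) (nCk+nC[k+1]≡[n+1]C[k+1] n (suc k)) (nCk+nC[k+1]≡[n+1]C[k+1] n k) ⟨
  suc (suc k) * (b + c) + suc k * (a + b)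
    ≡⟨ expand k a b c ⟩
  (suc (suc k) * c + suc k * b) + (suc k * b + k * a) + (a + b)
    ≡⟨ cong₂ (λ u v → u + v + (a + b)) (nCk-absorb n (suc k)) (nCk-absorb n k) ⟩
  n * b + n * a + (a + b)
    ≡⟨ collect n a b ⟩
  suc n * (a + b)
    ≡⟨ cong (suc n *_) (nCk+nC[k+1]≡[n+1]C[k+1] n k) ⟩
  suc n * (suc n C suc k) ∎
  where
  open ≡-Reasoning
  a = n C k
  b = n C suc k
  c = n C suc (suc k)
  expand : ∀ k a b c → suc (suc k) * (b + c) + suc k * (a + b) ≡
                       (suc (suc k) * c + suc k * b) + (suc k * b + k * a) + (a + b)
  expand = solve-∀
  collect : ∀ n a b → n * b + n * a + (a + b) ≡ suc n * (a + b)
  collect = solve-∀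

-- The right-hand side of the theorem, with C(n, -1) = C(n, -2) = 0.
bound : ℕ → ℕ → ℕ
bound n zero          = 0
bound n (suc zero)    = 1
bound n (suc (suc k)) = suc n C suc k + n C k

bound-pascal : ∀ n k → bound (suc n) (suc k) ≡ bound n (suc k) + bound n k
bound-pascal n zero = refl
bound-pascal n (suc zero) = begin
  suc (suc n) C 1 + suc n C 0             ≡⟨ cong₂ _+_ (nC1≡n (suc (suc n))) (nC0≡1 (suc n)) ⟩
  suc (suc n) + 1                         ≡⟨ arith n ⟩
  (suc n + 1) + 1                         ≡⟨ cong₂ (λ u v → (u + v) + 1) (nC1≡n (suc n)) (nC0≡1 n) ⟨
  (suc n C 1 + n C 0) + 1                 ∎
  where
  open ≡-Reasoning
  arith : ∀ n → suc (suc n) + 1 ≡ (suc n + 1) + 1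
  arith = solve-∀
bound-pascal n (suc (suc k)) = begin
  suc (suc n) C suc (suc k) + suc n C suc k
    ≡⟨ cong₂ _+_ (nCk+nC[k+1]≡[n+1]C[k+1] (suc n) (suc k)) (nCk+nC[k+1]≡[n+1]C[k+1] n k) ⟨
  (suc n C suc k + suc n C suc (suc k)) + (n C k + n C suc k)
    ≡⟨ arith (suc n C suc k) _ _ _ ⟩
  (suc n C suc (suc k) + n C suc k) + (suc n C suc k + n C k) ∎
  where
  open ≡-Reasoning
  arith : ∀ a b c e → (a + b) + (c + e) ≡ (b + e) + (a + c)
  arith = solve-∀

-- For n = 3j + 4 absorption gives (j+2) `c₂` = (2j+3) `c₁` and (j+1) `c₁` = (2j+4) `c₀`. Hence
-- (j+2) `c₂` = (j+2)(`c₁` + 2 `c₀`), and `c₁` + 2 `c₀` is the bound by Pascal's rule.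
nCk≡bound : ∀ n k → 3 * suc k ≡ n + 2 → n C suc k ≡ bound n (suc k)
nCk≡bound n zero    3≡n+2 = trans (nC1≡n n) (sym (+-cancelʳ-≡ 2 1 n 3≡n+2))
nCk≡bound n (suc j) eq    = *-cancelˡ-≡ c₂ (suc n C suc j + c₀) (suc (suc j)) (+-cancelʳ-≡ X _ _ (begin
  suc (suc j) * c₂ + X
    ≡⟨ +-assoc (suc (suc j) * c₂) _ _ ⟨
  (suc (suc j) * c₂ + suc j * c₁) + j * c₀
    ≡⟨ cong (_+ j * c₀) (nCk-absorb n (suc j)) ⟩
  n * c₁ + j * c₀
    ≡⟨ cong (λ m → m * c₁ + j * c₀) n≡ ⟩
  (4 + 3 * j) * c₁ + j * c₀
    ≡⟨ regroup₁ j c₀ c₁ ⟩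
  suc (suc j) * c₁ + suc j * c₁ + X
    ≡⟨ cong (suc (suc j) * c₁ + suc j * c₁ +_) (trans (nCk-absorb n j) (cong (_* c₀) n≡)) ⟩
  suc (suc j) * c₁ + suc j * c₁ + (4 + 3 * j) * c₀
    ≡⟨ regroup₂ j c₀ c₁ ⟩
  suc (suc j) * ((c₀ + c₁) + c₀) + X
    ≡⟨ cong (λ c → suc (suc j) * (c + c₀) + X) (nCk+nC[k+1]≡[n+1]C[k+1] n j) ⟩
  suc (suc j) * (suc n C suc j + c₀) + X ∎))
  where
  open ≡-Reasoning
  c₀ = n C j
  c₁ = n C suc j
  c₂ = n C suc (suc j)
  -- The terms that absorption would subtract; they are added to both sides and cancelled at the
  -- end.
  X = suc j * c₁ + j * c₀
  n≡ : n ≡ 4 + 3 * j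
  n≡ = +-cancelʳ-≡ 2 n _ (trans (sym eq) (arith j))
    where
    arith : ∀ j → 3 * suc (suc j) ≡ 4 + 3 * j + 2
    arith = solve-∀
  regroup₁ : ∀ j c₀ c₁ → (4 + 3 * j) * c₁ + j * c₀ ≡
                         suc (suc j) * c₁ + suc j * c₁ + (suc j * c₁ + j * c₀)
  regroup₁ = solve-∀
  regroup₂ : ∀ j c₀ c₁ → suc (suc j) * c₁ + suc j * c₁ + (4 + 3 * j) * c₀ ≡
                         suc (suc j) * ((c₀ + c₁) + c₀) + (suc j * c₁ + j * c₀)
  regroup₂ = solve-∀

-- Upper bounds by induction on n

size≤nCk : ∀ n k (F : Family n) → IsUniform k F → size F ≤ n C k
size≤nCk zero    zero    F unif = bit-mono {F []} {true} _
size≤nCk zero    (suc k) F unif = ≤-trans (≤-reflexive (size-empty F λ { [] A∈ → 0≢1+n (unif [] A∈) })) z≤n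
size≤nCk (suc n) zero    F unif = begin
  size [ F ]₀ + size [ F ]₁ ≡⟨ cong (size [ F ]₀ +_) (size-empty [ F ]₁ λ A A∈ → 1+n≢0 (unif _ A∈)) ⟩
  size [ F ]₀ + 0           ≡⟨ +-identityʳ _ ⟩
  size [ F ]₀               ≤⟨ size≤nCk n 0 [ F ]₀ (λ A → unif _) ⟩
  n C 0                     ≡⟨ trans (nC0≡1 n) (sym (nC0≡1 (suc n))) ⟩
  suc n C 0                 ∎
  where open ≤-Reasoning
size≤nCk (suc n) (suc k) F unif = begin
  size [ F ]₀ + size [ F ]₁ ≤⟨ +-mono-≤ (size≤nCk n (suc k) [ F ]₀ λ A → unif _)
                                         (size≤nCk n k [ F ]₁ λ A → suc-injective ∘ unif _) ⟩
  n C suc k + n C k         ≡⟨ +-comm (n C suc k) _ ⟩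
  n C k + n C suc k         ≡⟨ nCk+nC[k+1]≡[n+1]C[k+1] n k ⟩
  suc n C suc k             ∎
  where open ≤-Reasoning

-- The hypothesis is n ≥ 3k - 2 without truncated subtraction. All k are covered, since passing to
-- the link lowers k.
size≤bound : ∀ n k (F : Family n) → IsUniform k F → D≥2 F → 3 * k ≤ n + 2 → size F ≤ bound n k
size≤bound n zero F unif F≥2 _ = ≤-reflexive (size-empty F λ A A∈ →
  contradiction (F≥2 A A A A∈ A∈ A∈) (<⇒≱ (begin-strict
    d A A A ≡⟨ cong (λ m → m + m + m) (trans (cong ∣_∣ (∩-idem A)) (unif A A∈)) ⟩
    0       <⟨ s≤s z≤n ⟩
    2       ∎)))
  where open ≤-Reasoning
size≤bound n (suc k) F unif F≥2 3k≤n+2 with 3 * suc k ≟ n + 2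
size≤bound n (suc k) F unif F≥2 _ | yes 3k≡n+2 =
  ≤-trans (size≤nCk n (suc k) F unif) (≤-reflexive (nCk≡bound n k 3k≡n+2))
size≤bound zero (suc k) F unif F≥2 3k≤2 | no _ =
  contradiction (≤-trans (*-monoʳ-≤ 3 (s≤s (z≤n {k}))) 3k≤2) (<⇒≱ ≤-refl)
size≤bound (suc n) (suc k) F unif F≥2 3k≤n+3 | no 3k≢n+3 = begin
  size F                          ≡⟨ size≡ ⟨
  size [ family ]₀ + size [ family ]₁
    ≤⟨ +-mono-≤ (size≤bound n (suc k) [ family ]₀ (λ A → uniform _) [family]₀≥2 3k≤n+2)
                (size≤bound n k [ family ]₁ (λ A → suc-injective ∘ uniform _) [family]₁≥2
                            (≤-trans (*-monoʳ-≤ 3 (n≤1+n k)) 3k≤n+2)) ⟩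
  bound n (suc k) + bound n k     ≡⟨ bound-pascal n k ⟨
  bound (suc n) (suc k)           ∎
  where
  open ≤-Reasoning
  open Compression (compress (allFin n) F unif F≥2)
  -- Excluding equality gains exactly the unit lost with the removed point. This serves both
  -- recursive calls and the room needed in the link.
  3k≤n+2 : 3 * suc k ≤ n + 2
  3k≤n+2 = s≤s⁻¹ (≤∧≢⇒< 3k≤n+3 3k≢n+3)
  [family]₀≥2 : D≥2 [ family ]₀
  [family]₀≥2 A B D = d≥2 (false ∷ A) (false ∷ B) (false ∷ D)
  [family]₁≥2 : D≥2 [ family ]₁
  [family]₁≥2 = link-D≥2 family uniform d≥2 (λ x → stable (∈-allFin x)) 3k≤n+2

-- From Boolean predicates back to `g`

theorem2p1 : (n k : ℕ) → 1 ≤ n → 1 ≤ k → 3 * k ∸ 2 ≤ n → 4 ≤ 3 * k ∸ 2 →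
    g n k 2 ≤ ((n + 1) C (k ∸ 1)) + (n C (k ∸ 2))
theorem2p1 n (suc zero) _ _ _ (s≤s ())
theorem2p1 n k@(suc (suc j)) _ _ 3k∸2≤n _ with g-attained n k 2
... | 𝓕 , (𝓕! , unif , h) , length≡g = begin
  g n k 2                       ≡⟨ length≡g ⟨
  length 𝓕                      ≤⟨ length≤size 𝓕! ⟩
  size (fromList 𝓕)             ≤⟨ size≤bound n k (fromList 𝓕)
                                     (λ A A∈ → unif (∈-fromList⁻ A A∈))
                                     (λ A B D A∈ B∈ D∈ → h (∈-fromList⁻ A A∈) (∈-fromList⁻ B B∈) (∈-fromList⁻ D D∈))
                                     3k≤n+2 ⟩
  suc n C suc j + n C j         ≡⟨ cong (λ m → m C suc j + n C j) (+-comm 1 n) ⟩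
  (n + 1) C suc j + n C j       ∎
  where
  open ≤-Reasoning
  3k≤n+2 : 3 * k ≤ n + 2
  3k≤n+2 = ≤-trans (m≤n+m∸n (3 * k) 2) (≤-trans (+-monoʳ-≤ 2 3k∸2≤n) (≤-reflexive (+-comm 2 n)))
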